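{- The variety of subresiduated semilattices is the equivalent algebraic semantics (in the sense of Blok and Pigozzi) of the $\{\to,\wedge\}$-fragment of the logic $R4^\star$.
   Context: The logic $R4^\star$ is the Hilbert-style calculus in the language $\{\to,\vee,\wedge,\neg\}$ with axiom schemes: (Ax1) $\alpha\to\alpha$; (Ax2) $(\alpha\to\beta)\to((\beta\to\delta)\to(\alpha\to\delta))$; (Ax3) $(\alpha\to(\beta\to\delta))\to((\alpha\to\beta)\to(\alpha\to\delta))$; (C1) $(\alpha\wedge\beta)\to\alpha$; (C2) $(\alpha\wedge\beta)\to\beta$; (C3) $(\delta\to\alpha)\to((\delta\to\beta)\to(\delta\to(\alpha\wedge\beta)))$; (D1) $\alpha\to(\alpha\vee\beta)$; (D2) $\beta\to(\alpha\vee\beta)$; (D3) $(\alpha\to\delta)\to((\beta\to\delta)\to((\alpha\vee\beta)\to\delta))$; (N1) $\neg\alpha\to(\alpha\to\beta)$; (N2) $(\alpha\to\neg\alpha)\to\neg\alpha$; (Dist) $(\alpha\wedge(\beta\vee\delta))\to((\alpha\wedge\beta)\vee(\alpha\wedge\delta))$; and rules (MP) from $\alpha$ and $\alpha\to\beta$ infer $\beta$; (T) from $\alpha$ infer $\beta\to\alpha$. $\Gamma\vdash\alpha$ means there is a finite derivation of $\alpha$ from premises in $\Gamma$ (both rules may be applied to any previously derived formulas). The $\{\to,\wedge\}$-fragment is the restriction of this consequence relation to formulas built with $\to$ and $\wedge$ only. A subresiduated semilattice is an algebra $(A,\wedge,\to,1)$ of type $(2,2,0)$ such that $(A,\wedge)$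 is a meet-semilattice with greatest element $1$ (with associated order $\le$) and for all $x,y,z\in A$: (SR1) $(x\wedge y)\to y=1$; (SR2) $x\to y\le z\to(x\to y)$; (SR3) $x\wedge(x\to y)\le y$; (SR4) $z\to(x\wedge y)=(z\to x)\wedge(z\to y)$. In these algebras $1=x\to x$, so the constant $1$ is term-definable. A quasivariety $\mathbf{Q}$ is the equivalent algebraic semantics of a logic $\vdash$ if there are a finite set $\tau(x)$ of equations and a finite set $\Delta(x,y)$ of formulas such that, with $\models_{\mathbf{Q}}$ the equational consequence relation of $\mathbf{Q}$: $\Gamma\vdash\alpha$ iff $\tau(\Gamma)\models_{\mathbf{Q}}\tau(\alpha)$, and $x\approx y$ is equivalent under $\models_{\mathbf{Q}}$ to $\tau(\Delta(x,y))$. Here the transformers are $\tau(x)=\{x\approx 1\}$ (with $1$ standing for $x\to x$) and $\Delta(x,y)=\{x\to y,\,y\to x\}$. -}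

module Defs where

open import Algebra.Core using (Op₂)
open import Algebra.Definitions using (Congruent₂)
open import Algebra.Lattice.Structures using (IsBoundedMeetSemilattice)
open import Data.Fin.Base using (Fin; zero; suc)
open import Data.List.Base using (List; []; _∷_; map)
open import Data.List.Membership.Propositional renaming (_∈_ to _∈ˡ_)
open import Data.List.Relation.Unary.All using (All)
open import Data.Nat.Base using (ℕ)
open import Data.Product.Base using (_×_; _,_; ∃; ∃-syntax)
open import Data.Vec.Base using (Vec; []; _∷_; lookup)
open import Function.Bundles using (_⇔_)
open import Level using (Level; _⊔_; 0ℓ) renaming (suc to lsuc)
open import Relation.Binary.Core using (Rel)
open import Relation.Binary.Structures using (IsEquivalence)
open import Relation.Binary.PropositionalEquality.Core using (_≡_)
open import Relation.Unary using (Pred; _∈_)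
import Relation.Binary.Construct.NaturalOrder.Left as NaturalOrder

private
  variable
    a c ℓ p : Level
    X Y : Set

------------------------------------------------------------------------
-- The calculus R4⋆


data Formula : Set where
  var         : ℕ → Formula
  _⇒_ _∨_ _∧_ : Formula → Formula → Formula
  ¬_          : Formula → Formula

data Axiom : Pred Formula 0ℓ where
  Ax1  : ∀ α     → Axiom (α ⇒ α)
  Ax2  : ∀ α β δ → Axiom ((α ⇒ β) ⇒ ((β ⇒ δ) ⇒ (α ⇒ δ)))
  Ax3  : ∀ α β δ → Axiom ((α ⇒ (β ⇒ δ)) ⇒ ((α ⇒ β) ⇒ (α ⇒ δ)))
  C1   : ∀ α β   → Axiom ((α ∧ β) ⇒ α)
  C2   : ∀ α β   → Axiom ((α ∧ β) ⇒ β)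
  C3   : ∀ α β δ → Axiom ((δ ⇒ α) ⇒ ((δ ⇒ β) ⇒ (δ ⇒ (α ∧ β))))
  D1   : ∀ α β   → Axiom (α ⇒ (α ∨ β))
  D2   : ∀ α β   → Axiom (β ⇒ (α ∨ β))
  D3   : ∀ α β δ → Axiom ((α ⇒ δ) ⇒ ((β ⇒ δ) ⇒ ((α ∨ β) ⇒ δ)))
  N1   : ∀ α β   → Axiom ((¬ α) ⇒ (α ⇒ β))
  N2   : ∀ α     → Axiom ((α ⇒ (¬ α)) ⇒ (¬ α))
  Dist : ∀ α β δ → Axiom ((α ∧ (β ∨ δ)) ⇒ ((α ∧ β) ∨ (α ∧ δ)))

infix 4 _⊢_ _⊢⟨⇒,∧⟩_

data _⊢_ {ℓ : Level} (Γ : Pred Formula ℓ) : Formula → Set ℓ where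
  premise : ∀ {α}   → α ∈ Γ → Γ ⊢ α
  axiom   : ∀ {α}   → Axiom α → Γ ⊢ α
  MP      : ∀ {α β} → Γ ⊢ α → Γ ⊢ (α ⇒ β) → Γ ⊢ β
  T       : ∀ {α β} → Γ ⊢ α → Γ ⊢ (β ⇒ α)

------------------------------------------------------------------------
-- The {→,∧}-fragment

-- {→,∧}-terms.  Over ℕ these are the formulas of the fragment; over
-- Fin n they are the formulas in n variables used by transformers.
data Term (X : Set) : Set where
  var     : X → Term X
  _⇒_ _∧_ : Term X → Term X → Term X

⌜_⌝ : Term ℕ → Formula
⌜ var x ⌝ = var x
⌜ s ⇒ t ⌝ = ⌜ s ⌝ ⇒ ⌜ t ⌝
⌜ s ∧ t ⌝ = ⌜ s ⌝ ∧ ⌜ t ⌝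

-- Derivations may pass through formulas outside the fragment.
_⊢⟨⇒,∧⟩_ : Pred (Term ℕ) ℓ → Term ℕ → Set ℓ
Γ ⊢⟨⇒,∧⟩ α = (λ φ → ∃[ γ ] γ ∈ Γ × φ ≡ ⌜ γ ⌝) ⊢ ⌜ α ⌝

------------------------------------------------------------------------
-- Algebras for the language {→,∧}, equations and quasi-equations

-- As usual in universal algebra, carriers are nonempty.
record Algebra c ℓ : Set (lsuc (c ⊔ ℓ)) where
  infix  4 _≈_
  infixr 6 _⟶_
  infixr 7 _⊓_
  field
    Carrier       : Set c
    _≈_           : Rel Carrier ℓ
    _⟶_ _⊓_       : Op₂ Carrier
    isEquivalence : IsEquivalence _≈_
    ⟶-cong        : Congruent₂ _≈_ _⟶_
    ⊓-cong        : Congruent₂ _≈_ _⊓_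
    nonempty      : Carrier

  ⟦_⟧ : Term X → (X → Carrier) → Carrier
  ⟦ var x ⟧ v = v x
  ⟦ s ⇒ t ⟧ v = ⟦ s ⟧ v ⟶ ⟦ t ⟧ v
  ⟦ s ∧ t ⟧ v = ⟦ s ⟧ v ⊓ ⟦ t ⟧ v

infix 4 _≋_

data Equation (X : Set) : Set where
  _≋_ : Term X → Term X → Equation X

QuasiEquation : Set
QuasiEquation = List (Equation ℕ) × Equation ℕ

Satisfies : (A : Algebra c ℓ) → (X → Algebra.Carrier A) → Equation X → Set ℓ
Satisfies A v (s ≋ t) = ⟦ s ⟧ v ≈ ⟦ t ⟧ v
  where open Algebra A

IsVariety : Pred (Algebra c ℓ) p → Set (lsuc 0ℓ ⊔ lsuc (c ⊔ ℓ) ⊔ p)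
IsVariety K = ∃ λ (E : Pred (Equation ℕ) 0ℓ) → ∀ A →
  A ∈ K ⇔ (∀ e → e ∈ E → ∀ v → Satisfies A v e)

IsQuasivariety : Pred (Algebra c ℓ) p → Set (lsuc 0ℓ ⊔ lsuc (c ⊔ ℓ) ⊔ p)
IsQuasivariety K = ∃ λ (E : Pred QuasiEquation 0ℓ) → ∀ A →
  A ∈ K ⇔ (∀ es e → (es , e) ∈ E →
             ∀ v → All (Satisfies A v) es → Satisfies A v e)

EquationalConsequence : Pred (Algebra c ℓ) p → Pred (Equation ℕ) a →
                        Equation ℕ → Set (lsuc (c ⊔ ℓ) ⊔ p ⊔ a)
EquationalConsequence K Θ e = ∀ A → A ∈ K → ∀ v →
  (∀ d → d ∈ Θ → Satisfies A v d) → Satisfies A v e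

------------------------------------------------------------------------
-- Equivalent algebraic semantics

_[_] : ∀ {n} → Term (Fin n) → Vec (Term X) n → Term X
var i   [ ts ] = lookup ts i
(r ⇒ s) [ ts ] = (r [ ts ]) ⇒ (s [ ts ])
(r ∧ s) [ ts ] = (r [ ts ]) ∧ (s [ ts ])

substEquation : ∀ {n} → Vec (Term X) n → Equation (Fin n) → Equation X
substEquation ts (r ≋ s) = (r [ ts ]) ≋ (s [ ts ])

-- Finite sets are given by lists: τ is a finite set of equations in
-- one variable, Δ a finite set of formulas in two variables.
module Transformers (τ : List (Equation (Fin 1))) (Δ : List (Term (Fin 2))) where

  τ⟨_⟩ : Term ℕ → List (Equation ℕ)
  τ⟨ α ⟩ = map (substEquation (α ∷ [])) τ

  Δ⟨_,_⟩ : Term ℕ → Term ℕ → List (Term ℕ)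
  Δ⟨ α , β ⟩ = map (_[ α ∷ β ∷ [] ]) Δ

  τ[_] : Pred (Term ℕ) a → Pred (Equation ℕ) a
  τ[ Γ ] e = ∃[ γ ] γ ∈ Γ × e ∈ˡ τ⟨ γ ⟩

-- K is the equivalent algebraic semantics of the logic _⊩_, as
-- witnessed by the transformers τ and Δ.
record IsEquivalentAlgebraicSemantics
  (_⊩_ : Pred (Term ℕ) ℓ → Term ℕ → Set ℓ)
  (K : Pred (Algebra c ℓ) p)
  (τ : List (Equation (Fin 1))) (Δ : List (Term (Fin 2)))
  : Set (lsuc (c ⊔ ℓ) ⊔ p) where

  open Transformers τ Δ

  infix 4 _⊨_
  _⊨_ : Pred (Equation ℕ) a → Equation ℕ → Set (lsuc (c ⊔ ℓ) ⊔ p ⊔ a)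
  Θ ⊨ e = EquationalConsequence K Θ e

  field
    isQuasivariety : IsQuasivariety K
    algebraic      : ∀ Γ α → (Γ ⊩ α) ⇔ (∀ e → e ∈ˡ τ⟨ α ⟩ → τ[ Γ ] ⊨ e)
    equivalent-to  : ∀ α β e → e ∈ τ[ _∈ˡ Δ⟨ α , β ⟩ ] → (_≡ (α ≋ β)) ⊨ e
    equivalent-from : ∀ α β → τ[ _∈ˡ Δ⟨ α , β ⟩ ] ⊨ (α ≋ β)

------------------------------------------------------------------------
-- Subresiduated semilattices

record IsSubresiduatedSemilattice
  {A : Set c} (_≈_ : Rel A ℓ) (_⊓_ _⟶_ : Op₂ A) (𝟏 : A) : Set (c ⊔ ℓ) where

  -- x ≤ y is x ≈ x ⊓ y
  open NaturalOrder _≈_ _⊓_ using (_≤_)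

  field
    isBoundedMeetSemilattice : IsBoundedMeetSemilattice _≈_ _⊓_ 𝟏
    SR1 : ∀ x y   → ((x ⊓ y) ⟶ y) ≈ 𝟏
    SR2 : ∀ x y z → (x ⟶ y) ≤ (z ⟶ (x ⟶ y))
    SR3 : ∀ x y   → (x ⊓ (x ⟶ y)) ≤ y
    SR4 : ∀ x y z → (z ⟶ (x ⊓ y)) ≈ ((z ⟶ x) ⊓ (z ⟶ y))

-- The constant is not part of the language of the fragment; as
-- 𝟏 ≈ x ⟶ x, it is determined by the other operations.
SubresiduatedSemilattices : Pred (Algebra c ℓ) (c ⊔ ℓ)
SubresiduatedSemilattices A =
  ∃ λ 𝟏 → IsSubresiduatedSemilattice _≈_ _⊓_ _⟶_ 𝟏
  where open Algebra A

-- x ≈ 1, where 1 stands for x → x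
τ : List (Equation (Fin 1))
τ = (var zero ≋ (var zero ⇒ var zero)) ∷ []

Δ : List (Term (Fin 2))
Δ = (var zero ⇒ var (suc zero)) ∷ (var (suc zero) ⇒ var zero) ∷ []

{-# OPTIONS --safe #-}
module Submission where

-- Soundness has to account for derivations that leave the fragment, so
-- the whole calculus is interpreted in the downsets of a subresiduated
-- semilattice A: ∨ is union, ¬ is implication to the empty downset, and
-- P ⊸ Q is the union of the ↓d with d in the distinguished subalgebra
-- and d ∧ P ⊆ Q.  Since ↓x ⊸ ↓y = ↓(x → y), principal downsets embed A,
-- so nothing new about the fragment becomes derivable.  Completeness is
-- the Lindenbaum construction.

open import Defs
open import Algebra.Lattice.Structures using (module IsBoundedMeetSemilattice)
open import Data.Empty.Polymorphic using (⊥; ⊥-elim)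
open import Data.List.Base using ([])
open import Data.List.Membership.Propositional renaming (_∈_ to _∈ˡ_)
open import Data.List.Relation.Unary.All using ([])
open import Data.List.Relation.Unary.Any using (here; there)
open import Data.Nat.Base using (ℕ)
open import Data.Product.Base using (_×_; _,_; ∃; proj₁; proj₂)
open import Data.Sum.Base using (inj₁; inj₂)
open import Function.Bundles using (_⇔_; mk⇔; Equivalence)
open import Level using (Level; _⊔_; 0ℓ; Lift; lift)
open import Relation.Binary.Lattice using (MeetSemilattice)
import Relation.Binary.Construct.NaturalOrder.Left as NaturalOrder
import Relation.Binary.Lattice.Properties.MeetSemilattice as MeetSemilatticeProperties
open import Relation.Binary.Structures using (module IsEquivalence)
open import Relation.Binary.PropositionalEquality.Core using (_≡_; refl)
open import Relation.Unary using (Pred; _∈_; _⊆_; _∩_; _∪_)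

private
  variable
    c ℓ p : Level

-- Equational axioms for subresiduated semilattices.

data SubresiduatedEquation : Pred (Equation ℕ) 0ℓ where
  sl-assoc    : ((var 0 ∧ var 1) ∧ var 2 ≋ var 0 ∧ (var 1 ∧ var 2)) ∈ SubresiduatedEquation
  sl-comm     : (var 0 ∧ var 1 ≋ var 1 ∧ var 0) ∈ SubresiduatedEquation
  sl-idem     : (var 0 ∧ var 0 ≋ var 0) ∈ SubresiduatedEquation
  -- The top is absent from the language. Since `var 1` occurs only in `var 1 ⇒ var 1`, every
  -- `y ⇒ y` becomes an identity for `∧`.
  sl-identity : (var 0 ∧ (var 1 ⇒ var 1) ≋ var 0) ∈ SubresiduatedEquation
  sr1         : ((var 0 ∧ var 1) ⇒ var 1 ≋ var 2 ⇒ var 2) ∈ SubresiduatedEquation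
  sr2         : (var 0 ⇒ var 1 ≋ (var 0 ⇒ var 1) ∧ (var 2 ⇒ (var 0 ⇒ var 1))) ∈ SubresiduatedEquation
  sr3         : (var 0 ∧ (var 0 ⇒ var 1) ≋ (var 0 ∧ (var 0 ⇒ var 1)) ∧ var 1) ∈ SubresiduatedEquation
  sr4         : (var 2 ⇒ (var 0 ∧ var 1) ≋ (var 2 ⇒ var 0) ∧ (var 2 ⇒ var 1)) ∈ SubresiduatedEquation

-- Order and residuation in a subresiduated semilattice.

module SubresiduatedProperties
  (A : Algebra c ℓ) (A∈SRS : A ∈ SubresiduatedSemilattices) where

  open Algebra A public
  open NaturalOrder _≈_ _⊓_ public using (_≤_)

  𝟏 : Carrier
  𝟏 = proj₁ A∈SRS

  open IsSubresiduatedSemilattice (proj₂ A∈SRS) public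
  open IsBoundedMeetSemilattice _≈_ isBoundedMeetSemilattice public
    using (isMeetSemilattice; isMagma; isSemigroup; identityʳ; idem)
    renaming (refl to ≈-refl; sym to ≈-sym; trans to ≈-trans; comm to ⊓-comm)

  ≤-trans : ∀ {x y z} → x ≤ y → y ≤ z → x ≤ z
  ≤-trans = NaturalOrder.trans _≈_ _⊓_ isSemigroup

  ≤-reflexive : ∀ {x y} → x ≈ y → x ≤ y
  ≤-reflexive = NaturalOrder.reflexive _≈_ _⊓_ isMagma idem

  ≤-refl : ∀ {x} → x ≤ x
  ≤-refl = ≤-reflexive ≈-refl

  ≤-antisym : ∀ {x y} → x ≤ y → y ≤ x → x ≈ y
  ≤-antisym = NaturalOrder.antisym _≈_ _⊓_ isEquivalence ⊓-comm

  x⊓y≤x : ∀ x y → x ⊓ y ≤ x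
  x⊓y≤x = NaturalOrder.x∙y≤x _≈_ _⊓_ isMeetSemilattice

  x⊓y≤y : ∀ x y → x ⊓ y ≤ y
  x⊓y≤y = NaturalOrder.x∙y≤y _≈_ _⊓_ isMeetSemilattice

  ⊓-greatest : ∀ {x y z} → z ≤ x → z ≤ y → z ≤ x ⊓ y
  ⊓-greatest = NaturalOrder.∙-presʳ-≤ _≈_ _⊓_ isMeetSemilattice _

  x≤𝟏 : ∀ x → x ≤ 𝟏
  x≤𝟏 x = ≈-sym (identityʳ x)

  -- By definition `x ≤ y` is `x ≈ x ⊓ y`, so rewriting the antecedent gives an instance of SR1.
  x≤y⇒x⟶y≈𝟏 : ∀ {x y} → x ≤ y → x ⟶ y ≈ 𝟏
  x≤y⇒x⟶y≈𝟏 {x} {y} x≤y = ≈-trans (⟶-cong x≤y ≈-refl) (SR1 x y)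

  x⟶x≈𝟏 : ∀ x → x ⟶ x ≈ 𝟏
  x⟶x≈𝟏 x = x≤y⇒x⟶y≈𝟏 ≤-refl

  𝟏≤x⟶y⇒x≤y : ∀ {x y} → 𝟏 ≤ x ⟶ y → x ≤ y
  𝟏≤x⟶y⇒x≤y {x} {y} 𝟏≤x⟶y =
    ≤-trans (⊓-greatest ≤-refl (≤-trans (x≤𝟏 x) 𝟏≤x⟶y)) (SR3 x y)

  ⟶-monoʳ : ∀ z {x y} → x ≤ y → z ⟶ x ≤ z ⟶ y
  ⟶-monoʳ z x≤y = ≈-trans (⟶-cong ≈-refl x≤y) (SR4 _ _ z)

  -- The distinguished subalgebra of a subresiduated semilattice.
  Stable : Pred Carrier (c ⊔ ℓ)
  Stable d = ∀ z → d ≤ z ⟶ d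

  𝟏-stable : 𝟏 ∈ Stable
  𝟏-stable z = ≤-reflexive (≈-sym (x≤y⇒x⟶y≈𝟏 (x≤𝟏 z)))

  ⊓-stable : ∀ {d e} → d ∈ Stable → e ∈ Stable → d ⊓ e ∈ Stable
  ⊓-stable {d} {e} d∈S e∈S z =
    ≤-trans (⊓-greatest (≤-trans (x⊓y≤x d e) (d∈S z)) (≤-trans (x⊓y≤y d e) (e∈S z)))
            (≤-reflexive (≈-sym (SR4 d e z)))

  ⟶-stable : ∀ x y → x ⟶ y ∈ Stable
  ⟶-stable x y z = SR2 x y z

  -- Stability gives `d ≤ x ⟶ d`, and `d ≤ 𝟏 ≈ x ⟶ x`, so `d ≤ x ⟶ (d ⊓ x)` by SR4 and monotonicity
  -- finishes. With SR2 and SR3 this makes `x ⟶ y` the greatest stable `d` with `d ⊓ x ≤ y`.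
  residuate : ∀ {d x y} → d ∈ Stable → d ⊓ x ≤ y → d ≤ x ⟶ y
  residuate {d} {x} {y} d∈S d⊓x≤y =
    ≤-trans (⊓-greatest (d∈S x) (≤-trans (x≤𝟏 d) (≤-reflexive (≈-sym (x⟶x≈𝟏 x)))))
            (≤-trans (≤-reflexive (≈-sym (SR4 d x x))) (⟶-monoʳ x d⊓x≤y))

  τ-holds : ∀ {x} → 𝟏 ≤ x → x ≈ x ⟶ x
  τ-holds {x} 𝟏≤x = ≈-trans (≤-antisym (x≤𝟏 x) 𝟏≤x) (≈-sym (x⟶x≈𝟏 x))

  τ-holds⁻¹ : ∀ {x} → x ≈ x ⟶ x → 𝟏 ≤ x
  τ-holds⁻¹ {x} x≈x⟶x = ≤-reflexive (≈-sym (≈-trans x≈x⟶x (x⟶x≈𝟏 x)))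

-- Variety and quasivariety.

subresiduatedSemilattices-isVariety : IsVariety (SubresiduatedSemilattices {c} {ℓ})
subresiduatedSemilattices-isVariety = SubresiduatedEquation , λ A → mk⇔ (valid A) (models A)
  where
  valid : ∀ A → A ∈ SubresiduatedSemilattices →
          ∀ e → e ∈ SubresiduatedEquation → ∀ v → Satisfies A v e
  valid A A∈SRS _ e∈E v = go e∈E
    where
    open SubresiduatedProperties A A∈SRS
    open IsBoundedMeetSemilattice _≈_ isBoundedMeetSemilattice using (assoc)
    go : ∀ {e} → e ∈ SubresiduatedEquation → Satisfies A v e
    go sl-assoc    = assoc _ _ _
    go sl-comm     = ⊓-comm _ _
    go sl-idem     = idem _
    go sl-identity = ≈-trans (⊓-cong ≈-refl (x⟶x≈𝟏 _)) (identityʳ _)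
    go sr1         = ≈-trans (SR1 _ _) (≈-sym (x⟶x≈𝟏 _))
    go sr2         = SR2 _ _ _
    go sr3         = SR3 _ _
    go sr4         = SR4 _ _ _

  models : ∀ A → (∀ e → e ∈ SubresiduatedEquation → ∀ v → Satisfies A v e) →
           A ∈ SubresiduatedSemilattices
  -- Nonemptiness supplies the constant. Below, `nonempty` is also assigned to the variable `y` of
  -- `y ⇒ y` in `sr1` and `sl-identity`, so that this term evaluates to the chosen `𝟏`.
  models A sat = nonempty ⟶ nonempty , record
    { isBoundedMeetSemilattice = record
      { isCommutativeMonoid = record
        { isMonoid = record
          { isSemigroup = record
            { isMagma = record { isEquivalence = isEquivalence ; ∙-cong = ⊓-cong }
            ; assoc   = λ x y z → sat _ sl-assoc (assign x y z)
            }
          ; identity = (λ x → ≈-trans (comm _ x) (identity x)) , identity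
          }
        ; comm = comm
        }
      ; idem = λ x → sat _ sl-idem (assign x x x)
      }
    ; SR1 = λ x y → sat _ sr1 (assign x y nonempty)
    ; SR2 = λ x y z → sat _ sr2 (assign x y z)
    ; SR3 = λ x y → sat _ sr3 (assign x y x)
    ; SR4 = λ x y z → sat _ sr4 (assign x y z)
    }
    where
    open Algebra A
    open IsEquivalence isEquivalence using () renaming (trans to ≈-trans)

    assign : Carrier → Carrier → Carrier → ℕ → Carrier
    assign x y z 0 = x
    assign x y z 1 = y
    assign x y z _ = z

    comm : ∀ x y → x ⊓ y ≈ y ⊓ x
    comm x y = sat _ sl-comm (assign x y x)

    identity : ∀ x → x ⊓ (nonempty ⟶ nonempty) ≈ x
    identity x = sat _ sl-identity (assign x nonempty x)

isVariety⇒isQuasivariety : {K : Pred (Algebra c ℓ) p} → IsVariety K → IsQuasivariety K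
isVariety⇒isQuasivariety (E , K⇔E) =
  (λ (es , e) → es ≡ [] × e ∈ E) , λ A → mk⇔
    (λ { A∈K _ e (refl , e∈E) v _ → Equivalence.to (K⇔E A) A∈K e e∈E v })
    (λ sat → Equivalence.from (K⇔E A) (λ e e∈E v → sat [] e (refl , e∈E) v []))

-- Downset semantics of the full calculus.

module DownsetModel
  (A : Algebra c ℓ) (A∈SRS : A ∈ SubresiduatedSemilattices) where

  open SubresiduatedProperties A A∈SRS

  Downset : Pred (Pred Carrier (c ⊔ ℓ)) (c ⊔ ℓ)
  Downset P = ∀ {x y} → x ≤ y → y ∈ P → x ∈ P

  infixr 5 _⊸_

  -- For downsets P and Q, the last clause is equivalent to d ⊓ u ∈ Q for
  -- all u ∈ P; quantifying below d keeps the axioms free of meets.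
  _⊸_ : Pred Carrier (c ⊔ ℓ) → Pred Carrier (c ⊔ ℓ) → Pred Carrier (c ⊔ ℓ)
  (P ⊸ Q) z = ∃ λ d → d ∈ Stable × z ≤ d × (∀ {u} → u ≤ d → u ∈ P → u ∈ Q)

  module _ (v : ℕ → Carrier) where

    ⟪_⟫ : Formula → Pred Carrier (c ⊔ ℓ)
    ⟪ var n ⟫ z = Lift c (z ≤ v n)
    ⟪ φ ⇒ ψ ⟫   = ⟪ φ ⟫ ⊸ ⟪ ψ ⟫
    ⟪ φ ∨ ψ ⟫   = ⟪ φ ⟫ ∪ ⟪ ψ ⟫
    ⟪ φ ∧ ψ ⟫   = ⟪ φ ⟫ ∩ ⟪ ψ ⟫
    ⟪ ¬ φ ⟫     = ⟪ φ ⟫ ⊸ λ _ → ⊥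

    ⟪⟫-downset : ∀ φ → Downset ⟪ φ ⟫
    ⟪⟫-downset (var n) x≤y (lift y≤v)          = lift (≤-trans x≤y y≤v)
    ⟪⟫-downset (φ ⇒ ψ) x≤y (d , d∈S , y≤d , f) = d , d∈S , ≤-trans x≤y y≤d , f
    ⟪⟫-downset (φ ∨ ψ) x≤y (inj₁ y∈φ)          = inj₁ (⟪⟫-downset φ x≤y y∈φ)
    ⟪⟫-downset (φ ∨ ψ) x≤y (inj₂ y∈ψ)          = inj₂ (⟪⟫-downset ψ x≤y y∈ψ)
    ⟪⟫-downset (φ ∧ ψ) x≤y (y∈φ , y∈ψ)         = ⟪⟫-downset φ x≤y y∈φ , ⟪⟫-downset ψ x≤y y∈ψ
    ⟪⟫-downset (¬ φ)   x≤y (d , d∈S , y≤d , f) = d , d∈S , ≤-trans x≤y y≤d , f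

    ⊆⇒𝟏∈⊸ : ∀ {P Q} → P ⊆ Q → 𝟏 ∈ P ⊸ Q
    ⊆⇒𝟏∈⊸ P⊆Q = 𝟏 , 𝟏-stable , ≤-refl , λ _ → P⊆Q

    -- The common shape of Ax2, Ax3, C3 and D3: two implications yield a third. The meet of their
    -- stable witnesses is stable, and both hypotheses restrict to it.
    ⊸-intro₂ : ∀ {P Q P′ Q′ R₁ R₂} →
               (∀ {e} → (∀ {w} → w ≤ e → w ∈ P → w ∈ Q) →
                        (∀ {w} → w ≤ e → w ∈ P′ → w ∈ Q′) →
                        ∀ {w} → w ≤ e → w ∈ R₁ → w ∈ R₂) →
               𝟏 ∈ (P ⊸ Q) ⊸ (P′ ⊸ Q′) ⊸ R₁ ⊸ R₂
    ⊸-intro₂ h = ⊆⇒𝟏∈⊸ λ (d , d∈S , z≤d , f) → d , d∈S , z≤d , λ u≤d (e , e∈S , u≤e , g) →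
      d ⊓ e , ⊓-stable d∈S e∈S , ⊓-greatest u≤d u≤e ,
      h (λ w≤ → f (≤-trans w≤ (x⊓y≤x d e))) (λ w≤ → g (≤-trans w≤ (x⊓y≤y d e)))

    axiom-valid : ∀ {φ} → Axiom φ → 𝟏 ∈ ⟪ φ ⟫
    axiom-valid (Ax1 α)      = ⊆⇒𝟏∈⊸ λ a → a
    axiom-valid (Ax2 α β δ)  = ⊸-intro₂ λ f g w≤e a → g w≤e (f w≤e a)
    -- The inner implication holds at `w` with a witness above `w`, so it can be applied at `w`
    -- itself. N2 uses the same device.
    axiom-valid (Ax3 α β δ)  = ⊸-intro₂ λ f g w≤e a →
      let (_ , _ , w≤d , h) = f w≤e a in h w≤d (g w≤e a)
    axiom-valid (C1 α β)     = ⊆⇒𝟏∈⊸ proj₁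
    axiom-valid (C2 α β)     = ⊆⇒𝟏∈⊸ proj₂
    axiom-valid (C3 α β δ)   = ⊸-intro₂ λ f g w≤e x → f w≤e x , g w≤e x
    axiom-valid (D1 α β)     = ⊆⇒𝟏∈⊸ inj₁
    axiom-valid (D2 α β)     = ⊆⇒𝟏∈⊸ inj₂
    axiom-valid (D3 α β δ)   = ⊸-intro₂ λ where
      f g w≤e (inj₁ a) → f w≤e a
      f g w≤e (inj₂ b) → g w≤e b
    axiom-valid (N1 α β)     = ⊆⇒𝟏∈⊸ λ (d , d∈S , z≤d , f) →
      d , d∈S , z≤d , λ u≤d a → ⊥-elim (f u≤d a)
    axiom-valid (N2 α)       = ⊆⇒𝟏∈⊸ λ (d , d∈S , z≤d , f) →
      d , d∈S , z≤d , λ u≤d a → let (_ , _ , u≤e , g) = f u≤d a in g u≤e a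
    axiom-valid (Dist α β δ) = ⊆⇒𝟏∈⊸ λ where
      (a , inj₁ b) → inj₁ (a , b)
      (a , inj₂ d) → inj₂ (a , d)

    -- The designated value is the whole carrier: a downset containing `𝟏` contains everything,
    -- which is what rule T requires. For MP, the witness of the implication lies above `𝟏`, so it
    -- applies at `𝟏`.
    sound : ∀ {a} {Γ : Pred Formula a} → (∀ {φ} → φ ∈ Γ → 𝟏 ∈ ⟪ φ ⟫) →
            ∀ {φ} → Γ ⊢ φ → 𝟏 ∈ ⟪ φ ⟫
    sound Γ-valid (premise φ∈Γ) = Γ-valid φ∈Γ
    sound Γ-valid (axiom ax) = axiom-valid ax
    sound Γ-valid (MP ⊢φ ⊢φ⇒ψ) =
      let (_ , _ , 𝟏≤d , f) = sound Γ-valid ⊢φ⇒ψ in f 𝟏≤d (sound Γ-valid ⊢φ)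
    sound Γ-valid (T {α = φ} ⊢φ) = ⊆⇒𝟏∈⊸ λ _ → ⟪⟫-downset φ (x≤𝟏 _) (sound Γ-valid ⊢φ)

    -- Together the two inclusions say that a fragment term denotes the principal downset of its
    -- value. They are mutually recursive because `⇒` is contravariant on the left.
    ⟪⌜⌝⟫⇒≤ : ∀ t {z} → z ∈ ⟪ ⌜ t ⌝ ⟫ → z ≤ ⟦ t ⟧ v
    ≤⇒⟪⌜⌝⟫ : ∀ t {z} → z ≤ ⟦ t ⟧ v → z ∈ ⟪ ⌜ t ⌝ ⟫

    ⟪⌜⌝⟫⇒≤ (var n) (lift z≤v)            = z≤v
    -- Testing the implication at `d ⊓ ⟦ s ⟧ v` gives the inequality that `residuate` needs.
    ⟪⌜⌝⟫⇒≤ (s ⇒ t) (d , d∈S , z≤d , f)   = ≤-trans z≤d (residuate d∈S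
      (⟪⌜⌝⟫⇒≤ t (f (x⊓y≤x d _) (≤⇒⟪⌜⌝⟫ s (x⊓y≤y d _)))))
    ⟪⌜⌝⟫⇒≤ (s ∧ t) (z∈s , z∈t)           = ⊓-greatest (⟪⌜⌝⟫⇒≤ s z∈s) (⟪⌜⌝⟫⇒≤ t z∈t)

    ≤⇒⟪⌜⌝⟫ (var n) z≤v = lift z≤v
    ≤⇒⟪⌜⌝⟫ (s ⇒ t) z≤  = ⟦ s ⟧ v ⟶ ⟦ t ⟧ v , ⟶-stable _ _ , z≤ , λ u≤d u∈s →
      ≤⇒⟪⌜⌝⟫ t (≤-trans (⊓-greatest (⟪⌜⌝⟫⇒≤ s u∈s) u≤d) (SR3 _ _))
    ≤⇒⟪⌜⌝⟫ (s ∧ t) z≤  =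
      ≤⇒⟪⌜⌝⟫ s (≤-trans z≤ (x⊓y≤x _ _)) , ≤⇒⟪⌜⌝⟫ t (≤-trans z≤ (x⊓y≤y _ _))

-- Lindenbaum algebra of a fragment theory.

module Lindenbaum (c : Level) {ℓ : Level} (Γ : Pred (Term ℕ) ℓ) where

  infix 4 _≼_ _≃_

  _≼_ _≃_ : Term ℕ → Term ℕ → Set ℓ
  s ≼ t = Γ ⊢⟨⇒,∧⟩ (s ⇒ t)
  s ≃ t = s ≼ t × t ≼ s

  ≼-refl : ∀ {s} → s ≼ s
  ≼-refl = axiom (Ax1 _)

  ≼-trans : ∀ {s t u} → s ≼ t → t ≼ u → s ≼ u
  ≼-trans p q = MP q (MP p (axiom (Ax2 _ _ _)))

  ≼-app : ∀ {s t u} → s ≼ t ⇒ u → s ≼ t → s ≼ u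
  ≼-app p q = MP q (MP p (axiom (Ax3 _ _ _)))

  ∧-greatest : ∀ {s t u} → s ≼ t → s ≼ u → s ≼ t ∧ u
  ∧-greatest p q = MP q (MP p (axiom (C3 _ _ _)))

  meetSemilattice : MeetSemilattice 0ℓ ℓ ℓ
  meetSemilattice = record
    { Carrier = Term ℕ
    ; _≈_     = _≃_
    ; _≤_     = _≼_
    ; _∧_     = _∧_
    ; isMeetSemilattice = record
      { isPartialOrder = record
        { isPreorder = record
          { isEquivalence = record
            { refl  = ≼-refl , ≼-refl
            ; sym   = λ (p , q) → q , p
            ; trans = λ (p , q) (p′ , q′) → ≼-trans p p′ , ≼-trans q′ q
            }
          ; reflexive = proj₁
          ; trans     = ≼-trans
          }
        ; antisym = _,_
        }
      ; infimum = λ s t → axiom (C1 _ _) , axiom (C2 _ _) , λ _ → ∧-greatest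
      }
    }

  open MeetSemilatticeProperties meetSemilattice using (∧-cong; ∧-assoc; ∧-comm; ∧-idempotent)

  -- Ax2 changes the antecedent; Ax3, applied to `t ≼ t′` weakened by T, changes the consequent.
  ⇒-mono : ∀ {s s′ t t′} → s′ ≼ s → t ≼ t′ → s ⇒ t ≼ s′ ⇒ t′
  ⇒-mono p q = ≼-trans (MP p (axiom (Ax2 _ _ _))) (MP (T q) (axiom (Ax3 _ _ _)))

  ≼⇒≃∧ : ∀ {s t} → s ≼ t → s ≃ s ∧ t
  ≼⇒≃∧ p = ∧-greatest ≼-refl p , axiom (C1 _ _)

  -- Rule T collapses all consequences of `Γ` into a single class, the top of the algebra.
  ⊢⇒≃ : ∀ {s t} → Γ ⊢⟨⇒,∧⟩ s → Γ ⊢⟨⇒,∧⟩ t → s ≃ t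
  ⊢⇒≃ ⊢s ⊢t = T ⊢t , T ⊢s

  -- The quotient is kept as a setoid on fragment terms; `Lift` places the carrier at level `c`.
  algebra : Algebra c ℓ
  algebra = record
    { Carrier       = Lift c (Term ℕ)
    ; _≈_           = λ (lift s) (lift t) → s ≃ t
    ; _⟶_           = λ (lift s) (lift t) → lift (s ⇒ t)
    ; _⊓_           = λ (lift s) (lift t) → lift (s ∧ t)
    ; isEquivalence = record
      { refl  = ≼-refl , ≼-refl
      ; sym   = λ (p , q) → q , p
      ; trans = λ (p , q) (p′ , q′) → ≼-trans p p′ , ≼-trans q′ q
      }
    ; ⟶-cong        = λ (p , q) (p′ , q′) → ⇒-mono q p′ , ⇒-mono p q′
    ; ⊓-cong        = ∧-cong
    ; nonempty      = lift (var 0)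
    }

  open Algebra algebra using (⟦_⟧; isEquivalence; ⊓-cong)

  isSubresiduated : algebra ∈ SubresiduatedSemilattices
  isSubresiduated = lift (var 0 ⇒ var 0) , record
    { isBoundedMeetSemilattice = record
      { isCommutativeMonoid = record
        { isMonoid = record
          { isSemigroup = record
            { isMagma = record { isEquivalence = isEquivalence ; ∙-cong = ⊓-cong }
            ; assoc   = λ (lift s) (lift t) (lift u) → ∧-assoc s t u
            }
          ; identity = (λ _ → axiom (C2 _ _) , ∧-greatest (T ≼-refl) ≼-refl)
                     , (λ _ → axiom (C1 _ _) , ∧-greatest ≼-refl (T ≼-refl))
          }
        ; comm = λ (lift s) (lift t) → ∧-comm s t
        }
      ; idem = λ (lift s) → ∧-idempotent s
      }
    ; SR1 = λ _ _ → ⊢⇒≃ (axiom (C2 _ _)) ≼-refl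
    -- Suffixing gives x ⇒ y ≼ (y ⇒ y) ⇒ (x ⇒ y), and u ≼ y ⇒ y by T.
    ; SR2 = λ _ _ _ → ≼⇒≃∧ (≼-trans (axiom (Ax2 _ _ _)) (⇒-mono (T ≼-refl) ≼-refl))
    ; SR3 = λ _ _ → ≼⇒≃∧ (≼-app (axiom (C2 _ _)) (axiom (C1 _ _)))
    ; SR4 = λ _ _ _ →
        ∧-greatest (⇒-mono ≼-refl (axiom (C1 _ _))) (⇒-mono ≼-refl (axiom (C2 _ _)))
      -- C3 turns the first conjunct into an implication from the second, and Ax3 detaches it under
      -- the common antecedent.
      , ≼-app (≼-trans (axiom (C1 _ _)) (axiom (C3 _ _ _))) (axiom (C2 _ _))
    }

  generic : ℕ → Lift c (Term ℕ)
  generic n = lift (var n)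

  ⟦⟧-generic : ∀ t → ⟦ t ⟧ generic ≡ lift t
  ⟦⟧-generic (var n) = refl
  ⟦⟧-generic (s ⇒ t) rewrite ⟦⟧-generic s | ⟦⟧-generic t = refl
  ⟦⟧-generic (s ∧ t) rewrite ⟦⟧-generic s | ⟦⟧-generic t = refl

  satisfies⇔≃ : ∀ s t → Satisfies algebra generic (s ≋ t) ⇔ (s ≃ t)
  satisfies⇔≃ s t rewrite ⟦⟧-generic s | ⟦⟧-generic t = mk⇔ (λ p → p) (λ p → p)

-- Equivalence of the two consequence relations.

open Transformers τ Δ

τ-algebraic : ∀ {c ℓ} (Γ : Pred (Term ℕ) ℓ) α → (Γ ⊢⟨⇒,∧⟩ α) ⇔
  (∀ e → e ∈ˡ τ⟨ α ⟩ → EquationalConsequence (SubresiduatedSemilattices {c} {ℓ}) τ[ Γ ] e)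
τ-algebraic {c} Γ α = mk⇔ soundness completeness
  where
  soundness : Γ ⊢⟨⇒,∧⟩ α →
    ∀ e → e ∈ˡ τ⟨ α ⟩ → EquationalConsequence SubresiduatedSemilattices τ[ Γ ] e
  soundness ⊢α _ (here refl) A A∈SRS v Γ-holds =
    τ-holds (⟪⌜⌝⟫⇒≤ v α (sound v premises-valid ⊢α))
    where
    open SubresiduatedProperties A A∈SRS
    open DownsetModel A A∈SRS
    premises-valid : ∀ {φ} → (∃ λ γ → γ ∈ Γ × φ ≡ ⌜ γ ⌝) → 𝟏 ∈ ⟪_⟫ v φ
    premises-valid (γ , γ∈Γ , refl) =
      ≤⇒⟪⌜⌝⟫ v γ (τ-holds⁻¹ (Γ-holds _ (γ , γ∈Γ , here refl)))

  completeness :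
    (∀ e → e ∈ˡ τ⟨ α ⟩ → EquationalConsequence SubresiduatedSemilattices τ[ Γ ] e) →
    Γ ⊢⟨⇒,∧⟩ α
  -- The generic valuation gives `α ≃ α ⇒ α`; its second half is `(α ⇒ α) ⇒ α`, and Ax1 detaches
  -- `α`.
  completeness ⊨τα = MP ≼-refl (proj₂ (Equivalence.to (satisfies⇔≃ α (α ⇒ α))
    (⊨τα _ (here refl) algebra isSubresiduated generic Γ-holds)))
    where
    open Lindenbaum c Γ
    Γ-holds : ∀ d → d ∈ τ[ Γ ] → Satisfies algebra generic d
    Γ-holds _ (γ , γ∈Γ , here refl) =
      Equivalence.from (satisfies⇔≃ γ (γ ⇒ γ)) (⊢⇒≃ (premise (γ , γ∈Γ , refl)) ≼-refl)

lemma5p12 : ∀ {c ℓ : Level} →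
    IsVariety (SubresiduatedSemilattices {c} {ℓ}) ×
    IsEquivalentAlgebraicSemantics {ℓ = ℓ} {c = c} _⊢⟨⇒,∧⟩_ SubresiduatedSemilattices τ Δ
lemma5p12 = subresiduatedSemilattices-isVariety , record
  { isQuasivariety  = isVariety⇒isQuasivariety subresiduatedSemilattices-isVariety
  ; algebraic       = τ-algebraic
  ; equivalent-to   = to
  ; equivalent-from = from
  }
  where
  to : ∀ α β e → e ∈ τ[ _∈ˡ Δ⟨ α , β ⟩ ] →
       EquationalConsequence SubresiduatedSemilattices (_≡ (α ≋ β)) e
  to α β _ (_ , here refl , here refl) A A∈SRS v α≈β =
    τ-holds (≤-reflexive (≈-sym (x≤y⇒x⟶y≈𝟏 (≤-reflexive (α≈β _ refl)))))
    where open SubresiduatedProperties A A∈SRS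
  to α β _ (_ , there (here refl) , here refl) A A∈SRS v α≈β =
    τ-holds (≤-reflexive (≈-sym (x≤y⇒x⟶y≈𝟏 (≤-reflexive (≈-sym (α≈β _ refl))))))
    where open SubresiduatedProperties A A∈SRS

  from : ∀ α β → EquationalConsequence SubresiduatedSemilattices τ[ _∈ˡ Δ⟨ α , β ⟩ ] (α ≋ β)
  from α β A A∈SRS v Δ-holds =
    ≤-antisym (𝟏≤x⟶y⇒x≤y (τ-holds⁻¹ (Δ-holds _ (_ , here refl , here refl))))
              (𝟏≤x⟶y⇒x≤y (τ-holds⁻¹ (Δ-holds _ (_ , there (here refl) , here refl))))
    where open SubresiduatedProperties A A∈SRS
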